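{- Let $a,b,p,q$ be elements of a commutative ring with $1$, let $(w_n)_{n\ge 0}$ be defined by $w_0=a$, $w_1=b$ and $w_{n+2}=p\,w_{n+1}+q\,w_n$ for $n\ge 0$, let $k\ge 1$ be an integer, and let $\mathcal{H}_k(x)=\sum_{n\ge 0}w_n^k x^n$ (a formal power series). Let $\Delta_k$ and $\delta_k$ be the $k\times k$ matrices with polynomial entries in $x$ defined in the context. Then $$\mathcal{H}_k(x)=\frac{\det(\delta_k)}{\det(\Delta_k)}.$$
   Context: Conventions: $\binom{d}{j}=0$ if $j>d$, and any term carrying a factor $\binom{d}{j}$ with $j>d$ is read as $0$; $y^0=1$ for every ring element $y$; $[\,i=m\,]$ equals $1$ if $i=m$ and $0$ otherwise. Matrix $\Delta_k=\Delta_k(p,q)$ (rows and columns indexed by $1,\dots,k$): - Row $1$: $(\Delta_k)_{1,1}=1-p^kx-q^kx^2$, and $(\Delta_k)_{1,j+1}=-x\,p^{k-j}q^j\binom{k}{j}$ for $1\le j\le k-1$. - Row $i$ for $2\le i\le k$, with $d=k-i+1$ (so $d$ runs through $k-1,k-2,\dots,1$): $(\Delta_k)_{i,1}=-p^{d}x$, and $(\Delta_k)_{i,j+1}=[\,i=j+1\,]-x\,p^{d-j}q^j\binom{d}{j}$ for $1\le j\le k-1$ (the second term being $0$ when $j>d$). Matrix $\delta_k=\delta_k(p,q,a,b)$: it is obtained from $\Delta_k$ by replacing its first column. With $g_j=(b^j-a^jp^j)a^{k-j}$ for $j=1,\dots,k$, the first column of $\delta_k$ is $$\left(a^k+g_kx,\;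 g_{k-1}x,\; g_{k-2}x,\;\dots,\; g_1x\right)^{T},$$ and columns $2,\dots,k$ of $\delta_k$ coincide with those of $\Delta_k$. For example, for $k=1$: $\Delta_1=(1-px-qx^2)$ and $\delta_1=(a+(b-ap)x)$; for $k=2$: $\Delta_2=\begin{pmatrix}1-p^2x-q^2x^2&-2xpq\\-px&1-xq\end{pmatrix}$. The quotient is taken in the ring of formal power series in $x$; $\det(\Delta_k)$ has constant term $1$. -}

module Defs where

open import Algebra.Bundles using (CommutativeRing)
open import Algebra.Bundles.Raw using (RawRing)
import Algebra.Definitions.RawSemiring as RawSemiringDefs
open import Data.Bool.Base using (if_then_else_)
open import Data.Fin.Base as Fin using (Fin; toℕ; punchIn)
open import Data.Nat.Base as ℕ using (ℕ; _∸_; _≡ᵇ_)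
open import Data.Nat.Combinatorics using (_C_)

module Matrices {c ℓ} (R : RawRing c ℓ) where
  open RawRing R
  open RawSemiringDefs (RawRing.rawSemiring R) using (_^_; sum)

  Matrix : ℕ → ℕ → Set c
  Matrix m n = Fin m → Fin n → Carrier

  -- Laplace expansion along the first row; the minor omits row 0 and column j.
  det : ∀ {n} → Matrix n n → Carrier
  det {ℕ.zero}  M = 1#
  det {ℕ.suc n} M = sum λ (j : Fin (ℕ.suc n)) →
    (- 1#) ^ toℕ j * M Fin.zero j * det (λ r s → M (Fin.suc r) (punchIn j s))

-- A formal power series is its coefficient sequence; equality is coefficientwise.
module PowerSeries {c ℓ} (R : CommutativeRing c ℓ) where
  open CommutativeRing R
  open RawSemiringDefs (RawRing.rawSemiring rawRing) using (sum)

  Series : Set c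
  Series = ℕ → Carrier

  con : Carrier → Series
  con r ℕ.zero    = r
  con r (ℕ.suc _) = 0#

  X : Series
  X n = if n ≡ᵇ 1 then 1# else 0#

  seriesRing : RawRing c ℓ
  seriesRing = record
    { Carrier = Series
    ; _≈_     = λ f g → ∀ n → f n ≈ g n
    ; _+_     = λ f g n → f n + g n
    ; _*_     = λ f g n → sum λ (i : Fin (ℕ.suc n)) → f (toℕ i) * g (n ∸ toℕ i)
    ; -_      = λ f n → - f n
    ; 0#      = con 0#
    ; 1#      = con 1#
    }

module Scalars {c ℓ} (R : CommutativeRing c ℓ) (p q : CommutativeRing.Carrier R) where
  open CommutativeRing R
  open RawSemiringDefs (RawRing.rawSemiring rawRing) using (_^_; _×_)

  -- _C_ vanishes when j > d, so the truncated exponent d ∸ j is then irrelevant.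
  binomialTerm : ℕ → ℕ → Carrier
  binomialTerm d j = (d C j) × (p ^ (d ∸ j) * q ^ j)

  w : Carrier → Carrier → ℕ → Carrier
  w a b 0                   = a
  w a b 1                   = b
  w a b (ℕ.suc (ℕ.suc n)) = p * w a b (ℕ.suc n) + q * w a b n

  g : Carrier → Carrier → ℕ → ℕ → Carrier
  g a b k j = (b ^ j - a ^ j * p ^ j) * a ^ (k ∸ j)

module Horadam {c ℓ} (R : CommutativeRing c ℓ) (p q : CommutativeRing.Carrier R) where
  open CommutativeRing R using (Carrier)
  open RawSemiringDefs (RawRing.rawSemiring (CommutativeRing.rawRing R)) using ()
    renaming (_^_ to _^ʳ_)
  open PowerSeries R
  open Scalars R p q
  open RawRing seriesRing hiding (Carrier)
  open RawSemiringDefs (RawRing.rawSemiring seriesRing) using (_^_)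
  open Matrices seriesRing

  infixl 6 _-_
  _-_ : Series → Series → Series
  f - h = f + - h

  -- Indices start at 0. A 0-based row r corresponds to d = k - r, and the
  -- 0-based column j ≥ 1 is the column usually numbered j + 1.
  Δ : ∀ k → Matrix k k
  Δ k Fin.zero Fin.zero =
    1# - con (p ^ʳ k) * X - con (q ^ʳ k) * X ^ 2
  Δ k Fin.zero j@(Fin.suc _) =
    - (X * con (binomialTerm k (toℕ j)))
  Δ k i@(Fin.suc _) Fin.zero =
    - (con (p ^ʳ (k ∸ toℕ i)) * X)
  Δ k i@(Fin.suc _) j@(Fin.suc _) =
    (if toℕ i ≡ᵇ toℕ j then 1# else 0#)
      - X * con (binomialTerm (k ∸ toℕ i) (toℕ j))

  δ : Carrier → Carrier → ∀ k → Matrix k k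
  δ a b k Fin.zero      Fin.zero        = con (a ^ʳ k) + con (g a b k k) * X
  δ a b k i@(Fin.suc _) Fin.zero        = con (g a b k (k ∸ toℕ i)) * X
  δ a b k i             j@(Fin.suc _)   = Δ k i j

  𝓗 : Carrier → Carrier → ℕ → Series
  𝓗 a b k n = w a b n ^ʳ k

{-# OPTIONS --safe #-}
-- Put F₀ = 𝓗 and Fⱼ(x) = Σₙ wₙʲ wₙ₊₁ᵏ⁻ʲ xⁿ⁺¹ for 1 ≤ j < k. Expanding
-- (p wₙ₊₁ + q wₙ)ᵈ by the binomial theorem in wₙ₊₁ᵏ⁻ᵈ wₙ₊₂ᵈ shows that the
-- vector F solves the linear system Δ F = (first column of δ), so Cramer's rule
-- gives det δ = 𝓗 · det Δ, and det Δ is invertible because its constant term is 1.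
module Submission where

open import Algebra.Bundles using (CommutativeRing)
open import Algebra.Bundles.Raw using (RawRing)
open import Algebra.Definitions using (Invertible)
open import Algebra.Structures using (IsCommutativeRing)
import Algebra.Properties.CommutativeSemiring.Binomial as Binomial
import Algebra.Properties.CommutativeSemiring.Exp as CommutativeExp
import Algebra.Properties.Ring as RingProperties
import Algebra.Properties.Semiring.Exp as Exp
import Algebra.Properties.Semiring.Mult as Mult
import Algebra.Properties.Semiring.Sum as Sum
import Algebra.Solver.Ring.NaturalCoefficients.Default as Solver
open import Data.Bool.Base using (true; false; if_then_else_)
open import Data.Fin.Base as Fin using (Fin; zero; suc; toℕ; inject₁; punchIn)
open import Data.Fin.Induction using (<-weakInduction)
import Data.Fin.Permutation as Perm
open import Data.Fin.Properties using (toℕ<n; toℕ-fromℕ; toℕ-inject₁; toℕ≤pred[n])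
open import Data.Nat.Base as ℕ using (ℕ; zero; suc; _∸_; _≡ᵇ_; z≤n; s≤s)
open import Data.Nat.Combinatorics using (_C_; nCn≡1; k>n⇒nCk≡0; nCk≡nC[n∸k])
import Data.Nat.Properties as ℕ
open import Data.Product.Base using (Σ; ∃; _×_; _,_)
open import Data.Sum.Base as Sum⊎ using (_⊎_; inj₁; inj₂)
open import Function.Base using (_∘_)
open import Relation.Binary.PropositionalEquality as ≡ using (_≡_)
import Relation.Binary.Reasoning.Setoid as SetoidReasoning
open import Defs

-- Adjacent transpositions of column indices: `swap c` exchanges `inject₁ c` and `suc c`.

swap : ∀ {n} → Fin n → Fin (suc n) → Fin (suc n)
swap zero    zero          = suc zero
swap zero    (suc zero)    = zero
swap zero    (suc (suc j)) = suc (suc j)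
swap (suc c) zero          = zero
swap (suc c) (suc j)       = suc (swap c j)

swap-involutive : ∀ {n} (c : Fin n) j → swap c (swap c j) ≡ j
swap-involutive zero    zero          = ≡.refl
swap-involutive zero    (suc zero)    = ≡.refl
swap-involutive zero    (suc (suc j)) = ≡.refl
swap-involutive (suc c) zero          = ≡.refl
swap-involutive (suc c) (suc j)       = ≡.cong suc (swap-involutive c j)

swap-inject₁ : ∀ {n} (c : Fin n) → swap c (inject₁ c) ≡ suc c
swap-inject₁ zero    = ≡.refl
swap-inject₁ (suc c) = ≡.cong suc (swap-inject₁ c)

swapPermutation : ∀ {n} → Fin n → Perm.Permutation (suc n) (suc n)
swapPermutation c =
  Perm.permutation (swap c) (swap c) (swap-involutive c) (swap-involutive c)

-- The two ways in which an adjacent transposition meets the deletion of column `j`. If `j` is one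
-- of the two swapped columns, deleting its neighbour after the swap leaves the same columns in the
-- same order, so only the sign of the Laplace term changes. Otherwise `j` stays, and the swap
-- induces an adjacent transposition `c′` on the remaining columns.
swap-punchIn : ∀ {n} (c : Fin (suc n)) (j : Fin (suc (suc n))) →
  ((toℕ (swap c j) ≡ suc (toℕ j) ⊎ toℕ j ≡ suc (toℕ (swap c j))) ×
    (∀ s → swap c (punchIn (swap c j) s) ≡ punchIn j s))
  ⊎ (swap c j ≡ j × ∃ λ c′ → ∀ s → swap c (punchIn j s) ≡ punchIn j (swap c′ s))
swap-punchIn zero zero =
  inj₁ (inj₁ ≡.refl , λ { zero → ≡.refl ; (suc s) → ≡.refl })
swap-punchIn zero (suc zero) =
  inj₁ (inj₂ ≡.refl , λ { zero → ≡.refl ; (suc s) → ≡.refl })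
swap-punchIn {suc n} zero (suc (suc j)) =
  inj₂ (≡.refl , zero ,
    λ { zero → ≡.refl ; (suc zero) → ≡.refl ; (suc (suc s)) → ≡.refl })
swap-punchIn {suc n} (suc c) zero = inj₂ (≡.refl , c , λ s → ≡.refl)
swap-punchIn {suc n} (suc c) (suc j) with swap-punchIn c j
... | inj₁ (adjacent , eq) =
  inj₁ ( Sum⊎.map (≡.cong suc) (≡.cong suc) adjacent
       , λ { zero → ≡.refl ; (suc s) → ≡.cong suc (eq s) })
... | inj₂ (fixed , c′ , eq) =
  inj₂ ( ≡.cong suc fixed , suc c′
       , λ { zero → ≡.refl ; (suc s) → ≡.cong suc (eq s) })

-- Determinants over a commutative ring, up to Cramer's rule.

module Determinant {c ℓ} (R : CommutativeRing c ℓ) where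
  open CommutativeRing R hiding (zero)
  open Matrices rawRing
  open Sum semiring
  open Exp semiring using (_^_)
  open RingProperties ring
  open SetoidReasoning setoid
  open Solver commutativeSemiring using (solve; _:+_; _:*_; _:=_)

  minor : ∀ {m n} → Matrix (suc m) (suc n) → Fin (suc n) → Matrix m n
  minor M j r s = M (suc r) (punchIn j s)

  term : ∀ {n} → Matrix (suc n) (suc n) → Fin (suc n) → Carrier
  term M j = (- 1#) ^ toℕ j * M zero j * det (minor M j)

  sum-zero : ∀ {n} {t : Fin n → Carrier} → (∀ j → t j ≈ 0#) → sum t ≈ 0#
  sum-zero {n} eq = trans (sum-cong-≋ eq) (sum-replicate-zero n)

  sum-neg : ∀ {n} (t : Fin n → Carrier) → sum (λ j → - t j) ≈ - sum t
  sum-neg {zero}  t = sym -0#≈0#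
  sum-neg {suc n} t = trans (+-congˡ (sum-neg (t ∘ suc))) (-‿+-comm _ _)

  det-cong : ∀ {n} {M N : Matrix n n} → (∀ i j → M i j ≈ N i j) → det M ≈ det N
  det-cong {zero}  eq = refl
  det-cong {suc n} {M} {N} eq = sum-cong-≋ {x = term M} {y = term N} λ j →
    *-cong (*-congˡ (eq zero j)) (det-cong λ r s → eq (suc r) (punchIn j s))

  -- The expansion runs along a row while the hypothesis concerns a column: term `zero` contains an
  -- entry of that column, and every other minor keeps the column, so induction applies to it.
  det-zeroColumn : ∀ {n} (M : Matrix (suc n) (suc n)) →
    (∀ r → M r zero ≈ 0#) → det M ≈ 0#
  det-zeroColumn {n} M eq = sum-zero {t = term M} (zeroTerm n M eq)
    where
    zeroTerm : ∀ n (M : Matrix (suc n) (suc n)) → (∀ r → M r zero ≈ 0#) →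
      ∀ j → term M j ≈ 0#
    zeroTerm n       M eq zero    =
      trans (*-congʳ (trans (*-congˡ (eq zero)) (zeroʳ _))) (zeroˡ _)
    zeroTerm (suc n) M eq (suc j) =
      trans (*-congˡ (det-zeroColumn (minor M (suc j)) (eq ∘ suc))) (zeroʳ _)

  -- In term `zero` the combination sits in the entry, and the minor is free of column `zero`. In
  -- every other term the entry is common to the three matrices and the combination passes to column
  -- `zero` of the minor, where induction applies.
  det-linear : ∀ {n} (t : Carrier) (M N P : Matrix (suc n) (suc n)) →
    (∀ r → P r zero ≈ t * M r zero + N r zero) →
    (∀ r j → N r (suc j) ≈ M r (suc j)) → (∀ r j → P r (suc j) ≈ M r (suc j)) →
    det P ≈ t * det M + det N
  det-linear t M N P first N≈M P≈M = begin
    sum (term P)                                ≈⟨ sum-cong-≋ (linearTerm _ M N P first N≈M P≈M) ⟩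
    sum (λ j → t * term M j + term N j)         ≈⟨ ∑-distrib-+ (λ j → t * term M j) (term N) ⟩
    sum (λ j → t * term M j) + sum (term N)     ≈⟨ +-congʳ (*-distribˡ-sum t (term M)) ⟨
    t * sum (term M) + sum (term N)             ∎
    where
    linearTerm : ∀ n (M N P : Matrix (suc n) (suc n)) →
      (∀ r → P r zero ≈ t * M r zero + N r zero) →
      (∀ r j → N r (suc j) ≈ M r (suc j)) → (∀ r j → P r (suc j) ≈ M r (suc j)) →
      ∀ j → term P j ≈ t * term M j + term N j
    linearTerm n M N P first N≈M P≈M zero = begin
      1# * P zero zero * det (minor P zero)
        ≈⟨ *-cong (*-congˡ (first zero)) (det-cong λ r s → P≈M (suc r) s) ⟩
      1# * (t * M zero zero + N zero zero) * det (minor M zero)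
        ≈⟨ solve 5 (λ s t m n d → s :* (t :* m :+ n) :* d := t :* (s :* m :* d) :+ s :* n :* d)
             refl 1# t (M zero zero) (N zero zero) (det (minor M zero)) ⟩
      t * term M zero + 1# * N zero zero * det (minor M zero)
        ≈⟨ +-congˡ (*-congˡ (det-cong λ r s → N≈M (suc r) s)) ⟨
      t * term M zero + term N zero ∎
    linearTerm (suc n) M N P first N≈M P≈M j′@(suc j) = begin
      (- 1#) ^ toℕ j′ * P zero j′ * det (minor P j′)
        ≈⟨ *-cong (*-congˡ (P≈M zero j))
             (det-linear t (minor M j′) (minor N j′) (minor P j′) (first ∘ suc)
               (λ r s → N≈M (suc r) (punchIn j s)) (λ r s → P≈M (suc r) (punchIn j s))) ⟩
      (- 1#) ^ toℕ j′ * M zero j′ * (t * det (minor M j′) + det (minor N j′))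
        ≈⟨ solve 5 (λ s m t d e → s :* m :* (t :* d :+ e) := t :* (s :* m :* d) :+ s :* m :* e)
             refl ((- 1#) ^ toℕ j′) (M zero j′) t (det (minor M j′)) (det (minor N j′)) ⟩
      t * term M j′ + (- 1#) ^ toℕ j′ * M zero j′ * det (minor N j′)
        ≈⟨ +-congˡ (*-congʳ (*-congˡ (N≈M zero j))) ⟨
      t * term M j′ + term N j′ ∎

  replaceFirst : ∀ {m n} → (Fin m → Carrier) → Matrix m (suc n) → Matrix m (suc n)
  replaceFirst u M r zero    = u r
  replaceFirst u M r (suc j) = M r (suc j)

  -- Linearity in the first column, iterated. The number `m` of summands is independent of the
  -- matrix size, so that induction can peel off one summand at a time; the empty sum leaves a zero
  -- column.
  det-sum : ∀ {m n} (M : Matrix (suc n) (suc n)) (F : Fin m → Carrier)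
    (V : Fin (suc n) → Fin m → Carrier) →
    det (replaceFirst (λ r → sum λ j → F j * V r j) M)
      ≈ sum λ j → F j * det (replaceFirst (λ r → V r j) M)
  det-sum {zero}  M F V = det-zeroColumn (replaceFirst (λ _ → 0#) M) λ _ → refl
  det-sum {suc m} M F V = trans
    (det-linear (F zero) (replaceFirst (λ r → V r zero) M)
      (replaceFirst (λ r → sum λ j → F (suc j) * V r (suc j)) M)
      (replaceFirst (λ r → sum λ j → F j * V r j) M)
      (λ _ → refl) (λ _ _ → refl) (λ _ _ → refl))
    (+-congˡ (det-sum M (F ∘ suc) λ r → V r ∘ suc))

  -- The first two terms have equal entries, equal minors and opposite signs; all later minors keep
  -- both equal columns. Antisymmetry alone would give only `det M ≈ - det M`, which does not force
  -- `0#` in a ring where 2 is a zero divisor.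
  det-adjacent : ∀ {n} (M : Matrix (suc (suc n)) (suc (suc n))) →
    (∀ r → M r zero ≈ M r (suc zero)) → det M ≈ 0#
  det-adjacent {n} M eq = begin
    term M zero + (term M (suc zero) + sum (λ j → term M (suc (suc j))))
      ≈⟨ +-assoc _ _ _ ⟨
    term M zero + term M (suc zero) + sum (λ j → term M (suc (suc j)))
      ≈⟨ +-cong cancel (sum-zero (zeroTerm n M eq)) ⟩
    0# + 0#
      ≈⟨ +-identityˡ 0# ⟩
    0# ∎
    where
    minors : ∀ r s → minor M (suc zero) r s ≈ minor M zero r s
    minors r zero    = eq (suc r)
    minors r (suc s) = refl

    cancel : term M zero + term M (suc zero) ≈ 0#
    cancel = begin
      1# * M zero zero * det (minor M zero) + - 1# * 1# * M zero (suc zero) * det (minor M (suc zero))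
        ≈⟨ +-congˡ (*-cong (*-cong (*-identityʳ _) (sym (eq zero))) (det-cong minors)) ⟩
      1# * M zero zero * det (minor M zero) + - 1# * M zero zero * det (minor M zero)
        ≈⟨ solve 4 (λ s t m d → s :* m :* d :+ t :* m :* d := (s :+ t) :* (m :* d))
             refl 1# (- 1#) (M zero zero) (det (minor M zero)) ⟩
      (1# + - 1#) * (M zero zero * det (minor M zero))
        ≈⟨ *-congʳ (-‿inverseʳ 1#) ⟩
      0# * (M zero zero * det (minor M zero))
        ≈⟨ zeroˡ _ ⟩
      0# ∎

    zeroTerm : ∀ n (M : Matrix (suc (suc n)) (suc (suc n))) →
      (∀ r → M r zero ≈ M r (suc zero)) → ∀ j → term M (suc (suc j)) ≈ 0#
    zeroTerm (suc n) M eq j =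
      trans (*-congˡ (det-adjacent (minor M (suc (suc j))) (eq ∘ suc))) (zeroʳ _)

  sign-adjacent : ∀ {m n} → m ≡ suc n ⊎ n ≡ suc m → (- 1#) ^ m ≈ - (- 1#) ^ n
  sign-adjacent (inj₁ ≡.refl) = -1*x≈-x _
  sign-adjacent {m} (inj₂ ≡.refl) =
    trans (sym (-‿involutive _)) (-‿cong (sym (-1*x≈-x ((- 1#) ^ m))))

  -- Reindexing the expansion by the swap itself pairs each term with the negative of a term of
  -- `det M`: for a moved column the sign changes and the minor is the same, for a fixed column the
  -- minor is negated by induction.
  det-swap : ∀ {n} (c : Fin n) (M : Matrix (suc n) (suc n)) →
    det (λ r j → M r (swap c j)) ≈ - det M
  det-swap {suc n} c M = begin
    sum (term M′)                    ≈⟨ sum-permute (term M′) (swapPermutation c) ⟩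
    sum (λ j → term M′ (swap c j))   ≈⟨ sum-cong-≋ swapTerm ⟩
    sum (λ j → - term M j)           ≈⟨ sum-neg (term M) ⟩
    - sum (term M)                   ∎
    where
    M′ : Matrix (suc (suc n)) (suc (suc n))
    M′ r j = M r (swap c j)

    swapTerm : ∀ j → term M′ (swap c j) ≈ - term M j
    swapTerm j with swap-punchIn c j
    ... | inj₁ (adjacent , eq) = begin
      term M′ (swap c j)
        ≈⟨ *-cong
             (*-cong (sign-adjacent adjacent) (reflexive (≡.cong (M zero) (swap-involutive c j))))
             (det-cong λ r s → reflexive (≡.cong (M (suc r)) (eq s))) ⟩
      - (- 1#) ^ toℕ j * M zero j * det (minor M j)
        ≈⟨ *-congʳ (-‿distribˡ-* _ _) ⟨
      - ((- 1#) ^ toℕ j * M zero j) * det (minor M j)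
        ≈⟨ -‿distribˡ-* _ _ ⟨
      - term M j ∎
    ... | inj₂ (fixed , c′ , eq) = begin
      term M′ (swap c j)
        ≡⟨ ≡.cong (term M′) fixed ⟩
      term M′ j
        ≈⟨ *-cong (*-congˡ (reflexive (≡.cong (M zero) fixed)))
             (trans (det-cong λ r s → reflexive (≡.cong (M (suc r)) (eq s)))
                    (det-swap c′ (minor M j))) ⟩
      (- 1#) ^ toℕ j * M zero j * - det (minor M j)
        ≈⟨ -‿distribʳ-* _ _ ⟨
      - term M j ∎

  -- The repeated column is moved one place to the left at a time until it stands next to column
  -- `zero`. The transposition `swap (suc j)` fixes column `zero` and brings column `suc (suc j)` to
  -- position `suc (inject₁ j)`, as the induction hypothesis demands.
  det-repeated : ∀ {n} (j : Fin n) (M : Matrix (suc n) (suc n)) →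
    (∀ r → M r zero ≈ M r (suc j)) → det M ≈ 0#
  det-repeated {suc n} = <-weakInduction
    (λ j → ∀ M → (∀ r → M r zero ≈ M r (suc j)) → det M ≈ 0#)
    det-adjacent
    λ j ih M eq → begin
      det M
        ≈⟨ -‿involutive _ ⟨
      - - det M
        ≈⟨ -‿cong (det-swap (suc j) M) ⟨
      - det (λ r s → M r (swap (suc j) s))
        ≈⟨ -‿cong (ih (λ r s → M r (swap (suc j) s)) λ r → trans (eq r)
             (reflexive (≡.cong (λ s → M r (suc s)) (≡.sym (swap-inject₁ j))))) ⟩
      - 0#
        ≈⟨ -0#≈0# ⟩
      0# ∎

  -- Expanding the first column of `N` by linearity leaves one determinant per column of `M`; each
  -- except that of column `zero` has a repeated column. Nothing is inverted, so the rule holds over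
  -- any commutative ring.
  cramer : ∀ {n} (M N : Matrix (suc n) (suc n)) (F : Fin (suc n) → Carrier) →
    (∀ r → N r zero ≈ sum λ j → F j * M r j) →
    (∀ r j → N r (suc j) ≈ M r (suc j)) →
    det N ≈ F zero * det M
  cramer M N F first rest = begin
    det N
      ≈⟨ det-cong {M = N} {N = solved} (λ { r zero → first r ; r (suc j) → rest r j }) ⟩
    det solved
      ≈⟨ det-sum M F M ⟩
    F zero * det (column zero) + sum (λ j → F (suc j) * det (column (suc j)))
      ≈⟨ +-cong
           (*-congˡ (det-cong {M = column zero} {N = M} λ { r zero → refl ; r (suc j) → refl }))
           (sum-zero λ j → trans
             (*-congˡ (det-repeated j (column (suc j)) λ r → refl)) (zeroʳ _)) ⟩
    F zero * det M + 0#
      ≈⟨ +-identityʳ _ ⟩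
    F zero * det M ∎
    where
    solved : Matrix _ _
    solved = replaceFirst (λ r → sum λ j → F j * M r j) M

    column : ∀ j → Matrix _ _
    column j = replaceFirst (λ r → M r j) M

-- The two shapes of rows in the linear system, over any commutative ring.

module LinearSystem {c ℓ} (R : CommutativeRing c ℓ) where
  open CommutativeRing R hiding (zero)
  open Sum semiring
  open Exp semiring using (_^_)
  open RingProperties ring
  open Determinant R using (sum-zero; sum-neg)
  open SetoidReasoning setoid
  open Solver commutativeSemiring using (solve; _:+_; _:*_; _:=_)

  sum-indicator : ∀ {n} (r : Fin n) (t : Fin n → Carrier) →
    sum (λ s → t s * (if toℕ r ≡ᵇ toℕ s then 1# else 0#)) ≈ t r
  sum-indicator zero t = trans
    (+-cong (*-identityʳ (t zero)) (sum-zero {t = λ s → t (suc s) * 0#} λ s → zeroʳ _))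
    (+-identityʳ _)
  sum-indicator (suc r) t =
    trans (+-cong (zeroʳ (t zero)) (sum-indicator r (t ∘ suc))) (+-identityˡ _)

  sum-scaled : ∀ {n} (x : Carrier) (t u : Fin n → Carrier) →
    sum (λ s → t s * - (x * u s)) ≈ - (x * sum λ s → t s * u s)
  sum-scaled x t u = begin
    sum (λ s → t s * - (x * u s))       ≈⟨ sum-cong-≋ (λ s → trans (sym (-‿distribʳ-* (t s) (x * u s)))
                                             (-‿cong (solve 3 (λ t x u → t :* (x :* u) := x :* (t :* u)) refl (t s) x (u s)))) ⟩
    sum (λ s → - (x * (t s * u s)))     ≈⟨ sum-neg (λ s → x * (t s * u s)) ⟩
    - sum (λ s → x * (t s * u s))       ≈⟨ -‿cong (*-distribˡ-sum x (λ s → t s * u s)) ⟨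
    - (x * sum (λ s → t s * u s))       ∎

  -- To be used with `x` the series `X`, `h` the series `𝓗` and `t` the other unknowns. The left
  -- side is literally what a row of `Δ` below the first unfolds to; the right side isolates one
  -- unknown and a single multiple of `x`.
  lowerRow : ∀ {n} (x h e : Carrier) (t u : Fin n → Carrier) (r : Fin n) →
    h * - (e * x) + sum (λ s → t s * ((if toℕ r ≡ᵇ toℕ s then 1# else 0#) + - (x * u s)))
      ≈ t r + - (x * (h * e + sum λ s → t s * u s))
  lowerRow x h e t u r = begin
    h * - (e * x) + sum (λ s → t s * (I s + - (x * u s)))
      ≈⟨ +-cong
           (trans (sym (-‿distribʳ-* h (e * x)))
             (-‿cong (solve 3 (λ h e x → h :* (e :* x) := x :* (h :* e)) refl h e x)))
           (trans (sum-cong-≋ (λ s → distribˡ (t s) (I s) (- (x * u s))))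
             (trans (∑-distrib-+ (λ s → t s * I s) (λ s → t s * - (x * u s)))
               (+-cong (sum-indicator r t) (sum-scaled x t u)))) ⟩
    - (x * (h * e)) + (t r + - (x * y))
      ≈⟨ solve 3 (λ a b c → a :+ (b :+ c) := b :+ (a :+ c)) refl (- (x * (h * e))) (t r) (- (x * y)) ⟩
    t r + (- (x * (h * e)) + - (x * y))
      ≈⟨ +-congˡ (trans (-‿+-comm _ _) (-‿cong (sym (distribˡ x (h * e) y)))) ⟩
    t r + - (x * (h * e + y)) ∎
    where
    I : Fin _ → Carrier
    I s = if toℕ r ≡ᵇ toℕ s then 1# else 0#

    y : Carrier
    y = sum λ s → t s * u s

  -- The analogue for the first row, where `e′` will be the constant `q ^ k`. The quadratic term is
  -- written as two nested products by `x`, so that its coefficients can be read off by shifting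
  -- twice.
  firstRow : ∀ {n} (x h e e′ : Carrier) (t u : Fin n → Carrier) →
    h * (1# + - (e * x) + - (e′ * x ^ 2)) + sum (λ s → t s * - (x * u s))
      ≈ h + - (x * (h * e + sum λ s → t s * u s)) + - (x * (x * (h * e′)))
  firstRow x h e e′ t u = begin
    h * (1# + - (e * x) + - (e′ * x ^ 2)) + sum (λ s → t s * - (x * u s))
      ≈⟨ +-cong
           (trans (solve 4 (λ h o a b → h :* (o :+ a :+ b) := h :* o :+ h :* a :+ h :* b)
                     refl h 1# (- (e * x)) (- (e′ * x ^ 2)))
             (+-cong (+-cong (*-identityʳ h) (trans (sym (-‿distribʳ-* h (e * x)))
               (-‿cong (solve 3 (λ h e x → h :* (e :* x) := x :* (h :* e)) refl h e x))))
               (trans (sym (-‿distribʳ-* h (e′ * x ^ 2)))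
                 (-‿cong (trans (*-congˡ (*-congˡ (*-congˡ (*-identityʳ x))))
                   (solve 3 (λ h e x → h :* (e :* (x :* x)) := x :* (x :* (h :* e))) refl h e′ x))))))
           (sum-scaled x t u) ⟩
    h + - (x * (h * e)) + z + - (x * y)
      ≈⟨ solve 4 (λ h a z b → h :+ a :+ z :+ b := h :+ (a :+ b) :+ z)
           refl h (- (x * (h * e))) z (- (x * y)) ⟩
    h + (- (x * (h * e)) + - (x * y)) + z
      ≈⟨ +-congʳ (+-congˡ (trans (-‿+-comm _ _) (-‿cong (sym (distribˡ x (h * e) y))))) ⟩
    h + - (x * (h * e + y)) + z ∎
    where
    y z : Carrier
    y = sum λ s → t s * u s
    z = - (x * (x * (h * e′)))

-- Formal power series: the commutative ring, division and constant terms.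

module PowerSeriesProperties {c ℓ} (R : CommutativeRing c ℓ) where
  open CommutativeRing R hiding (zero)
  open PowerSeries R
  open Sum semiring
  open RingProperties ring
  open SetoidReasoning setoid
  open Solver commutativeSemiring using (solve; _:+_; _:*_; _:=_)
  private module S = RawRing seriesRing
  open S using () renaming (_≈_ to _≋_; _*_ to _⊛_)

  tail : Series → Series
  tail f n = f (suc n)

  -- The Cauchy product unfolds definitionally to
  -- (f ⊛ g) (suc n) = f 0 * g (suc n) + (tail f ⊛ g) n.

  ⊛-cong : ∀ {f f′ g g′} → f ≋ f′ → g ≋ g′ → f ⊛ g ≋ f′ ⊛ g′
  ⊛-cong f≋f′ g≋g′ n = sum-cong-≋ {suc n} λ i → *-cong (f≋f′ (toℕ i)) (g≋g′ (n ∸ toℕ i))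

  ⊛-zeroˡ : ∀ {f} → (∀ n → f n ≈ 0#) → ∀ g n → (f ⊛ g) n ≈ 0#
  ⊛-zeroˡ f≈0 g n = trans
    (sum-cong-≋ {suc n} λ i → trans (*-congʳ (f≈0 (toℕ i))) (zeroˡ (g (n ∸ toℕ i))))
    (sum-replicate-zero (suc n))

  con-⊛ : ∀ r f n → (con r ⊛ f) n ≈ r * f n
  con-⊛ r f zero    = +-identityʳ _
  con-⊛ r f (suc n) = trans (+-congˡ (⊛-zeroˡ (λ _ → refl) f n)) (+-identityʳ _)

  -- The mirror image of the definitional recursion, splitting off the last summand in place of the
  -- first. Exchanging the factors turns one recursion into the other, which yields commutativity by
  -- induction.
  ⊛-sucʳ : ∀ f g n → (f ⊛ g) (suc n) ≈ f (suc n) * g 0 + (f ⊛ tail g) n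
  ⊛-sucʳ f g zero    = solve 3 (λ a b z → a :+ (b :+ z) := b :+ (a :+ z))
    refl (f 0 * g 1) (f 1 * g 0) 0#
  ⊛-sucʳ f g (suc n) = trans (+-congˡ (⊛-sucʳ (tail f) g n))
    (solve 3 (λ a b z → a :+ (b :+ z) := b :+ (a :+ z))
      refl (f 0 * g (suc (suc n))) (f (suc (suc n)) * g 0) ((tail f ⊛ tail g) n))

  ⊛-comm : ∀ f g → f ⊛ g ≋ g ⊛ f
  ⊛-comm f g zero    = +-congʳ (*-comm _ _)
  ⊛-comm f g (suc n) =
    trans (+-cong (*-comm _ _) (⊛-comm (tail f) g n)) (sym (⊛-sucʳ g f n))

  ⊛-distribʳ : ∀ h f g → (f S.+ g) ⊛ h ≋ (f ⊛ h) S.+ (g ⊛ h)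
  ⊛-distribʳ h f g zero    = trans
    (solve 4 (λ f g h z → (f :+ g) :* h :+ z := f :* h :+ z :+ g :* h) refl (f 0) (g 0) (h 0) 0#)
    (+-congˡ (sym (+-identityʳ _)))
  ⊛-distribʳ h f g (suc n) = trans
    (+-cong (distribʳ _ _ _) (⊛-distribʳ h (tail f) (tail g) n))
    (solve 4 (λ a b c d → a :+ b :+ (c :+ d) := a :+ c :+ (b :+ d)) refl
      (f 0 * h (suc n)) (g 0 * h (suc n)) ((tail f ⊛ h) n) ((tail g ⊛ h) n))

  ⊛-scale : ∀ r f g n → ((λ m → r * f m) ⊛ g) n ≈ r * (f ⊛ g) n
  ⊛-scale r f g n = trans
    (sum-cong-≋ {suc n} λ i → *-assoc r (f (toℕ i)) (g (n ∸ toℕ i)))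
    (sym (*-distribˡ-sum {suc n} r λ i → f (toℕ i) * g (n ∸ toℕ i)))

  -- Induction works because `tail (f ⊛ g)` is definitionally `f 0` times `tail g`, plus
  -- `tail f ⊛ g`; distributivity and `⊛-scale` then separate the two parts.
  ⊛-assoc : ∀ f g h → (f ⊛ g) ⊛ h ≋ f ⊛ (g ⊛ h)
  ⊛-assoc f g h zero    = +-congʳ (trans (*-congʳ (+-identityʳ _))
    (trans (*-assoc _ _ _) (*-congˡ (sym (+-identityʳ _)))))
  ⊛-assoc f g h (suc n) = begin
    (f 0 * g 0 + 0#) * h (suc n) + (tail (f ⊛ g) ⊛ h) n
      ≈⟨ +-cong (*-congʳ (+-identityʳ _))
           (⊛-distribʳ h (λ m → f 0 * g (suc m)) (tail f ⊛ g) n) ⟩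
    f 0 * g 0 * h (suc n) + (((λ m → f 0 * g (suc m)) ⊛ h) n + ((tail f ⊛ g) ⊛ h) n)
      ≈⟨ +-congˡ (+-cong (⊛-scale (f 0) (tail g) h n) (⊛-assoc (tail f) g h n)) ⟩
    f 0 * g 0 * h (suc n) + (f 0 * (tail g ⊛ h) n + (tail f ⊛ (g ⊛ h)) n)
      ≈⟨ solve 5 (λ f g h a b → f :* g :* h :+ (f :* a :+ b) := f :* (g :* h :+ a) :+ b)
           refl (f 0) (g 0) (h (suc n)) ((tail g ⊛ h) n) ((tail f ⊛ (g ⊛ h)) n) ⟩
    f 0 * (g ⊛ h) (suc n) + (tail f ⊛ (g ⊛ h)) n ∎

  -- The zero series is `con 0#`, which reduces only at a constructor, so the pointwise ring laws
  -- need this case split.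
  con0≈0 : ∀ n → con 0# n ≈ 0#
  con0≈0 zero    = refl
  con0≈0 (suc n) = refl

  seriesIsCommutativeRing : IsCommutativeRing _≋_ S._+_ _⊛_ S.-_ S.0# S.1#
  seriesIsCommutativeRing = record
    { isRing = record
      { +-isAbelianGroup = record
        { isGroup = record
          { isMonoid = record
            { isSemigroup = record
              { isMagma = record
                { isEquivalence = record
                  { refl  = λ n → refl
                  ; sym   = λ eq n → sym (eq n)
                  ; trans = λ eq eq′ n → trans (eq n) (eq′ n)
                  }
                ; ∙-cong = λ eq eq′ n → +-cong (eq n) (eq′ n)
                }
              ; assoc = λ f g h n → +-assoc (f n) (g n) (h n)
              }
            ; identity = (λ f n → trans (+-congʳ (con0≈0 n)) (+-identityˡ (f n)))
                       , (λ f n → trans (+-congˡ (con0≈0 n)) (+-identityʳ (f n)))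
            }
          ; inverse = (λ f n → trans (-‿inverseˡ (f n)) (sym (con0≈0 n)))
                    , (λ f n → trans (-‿inverseʳ (f n)) (sym (con0≈0 n)))
          ; ⁻¹-cong = λ eq n → -‿cong (eq n)
          }
        ; comm = λ f g n → +-comm (f n) (g n)
        }
      ; *-cong = λ {f} {f′} {g} {g′} → ⊛-cong {f} {f′} {g} {g′}
      ; *-assoc = ⊛-assoc
      ; *-identity = oneˡ , λ f n → trans (⊛-comm f S.1# n) (oneˡ f n)
      ; distrib = (λ h f g n → trans (⊛-comm h (f S.+ g) n)
                    (trans (⊛-distribʳ h f g n) (+-cong (⊛-comm f h n) (⊛-comm g h n))))
                , ⊛-distribʳ
      }
    ; *-comm = ⊛-comm
    }
    where
    oneˡ : ∀ f → S.1# ⊛ f ≋ f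
    oneˡ f n = trans (con-⊛ 1# f n) (*-identityˡ (f n))

  seriesCommutativeRing : CommutativeRing c ℓ
  seriesCommutativeRing = record { isCommutativeRing = seriesIsCommutativeRing }

  -- Long division of r by a series f with constant term 1.
  quotient : Series → Series → Series
  quotient f r zero    = r 0
  quotient f r (suc n) = quotient f (λ m → r (suc m) - r 0 * f (suc m)) n

  -- With constant term `1#`, each quotient coefficient is the leading coefficient of the current
  -- remainder. The recursive call multiplies back to the shifted remainder, and `r 0 * f (suc n)`
  -- restores what was subtracted.
  quotient-⊛ : ∀ f → f 0 ≈ 1# → ∀ r → quotient f r ⊛ f ≋ r
  quotient-⊛ f f₀≈1 r zero    =
    trans (+-identityʳ _) (trans (*-congˡ f₀≈1) (*-identityʳ _))
  quotient-⊛ f f₀≈1 r (suc n) = begin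
    r 0 * f (suc n) + (quotient f (λ m → r (suc m) - r 0 * f (suc m)) ⊛ f) n
      ≈⟨ +-congˡ (quotient-⊛ f f₀≈1 (λ m → r (suc m) - r 0 * f (suc m)) n) ⟩
    r 0 * f (suc n) + (r (suc n) - r 0 * f (suc n))
      ≈⟨ +-assoc _ _ _ ⟨
    r 0 * f (suc n) + r (suc n) - r 0 * f (suc n)
      ≈⟨ xyx⁻¹≈y _ _ ⟩
    r (suc n) ∎

  ⊛-con : ∀ f r n → (f ⊛ con r) n ≈ f n * r
  ⊛-con f r n = trans (⊛-comm f (con r) n) (trans (con-⊛ r f n) (*-comm r (f n)))

  X-⊛-zero : ∀ f → (X ⊛ f) 0 ≈ 0#
  X-⊛-zero f = trans (+-identityʳ _) (zeroˡ (f 0))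

  X-⊛-suc : ∀ f n → (X ⊛ f) (suc n) ≈ f n
  X-⊛-suc f n = begin
    0# * f (suc n) + (tail X ⊛ f) n  ≈⟨ +-cong (zeroˡ _) (⊛-cong {g = f} tailX (λ _ → refl) n) ⟩
    0# + (con 1# ⊛ f) n              ≈⟨ +-identityˡ _ ⟩
    (con 1# ⊛ f) n                   ≈⟨ con-⊛ 1# f n ⟩
    1# * f n                         ≈⟨ *-identityˡ _ ⟩
    f n                              ∎
    where
    tailX : tail X ≋ con 1#
    tailX zero    = refl
    tailX (suc n) = refl

  con-X-suc : ∀ r n → (con r ⊛ X) (suc n) ≈ con r n
  con-X-suc r n = trans (⊛-comm (con r) X (suc n)) (X-⊛-suc (con r) n)

  con-X-zero : ∀ r → (con r ⊛ X) 0 ≈ 0#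
  con-X-zero r = trans (⊛-comm (con r) X 0) (X-⊛-zero (con r))

  private module SeriesSum = Sum (CommutativeRing.semiring seriesCommutativeRing)

  sum-coefficient : ∀ {m} (t : Fin m → Series) n → SeriesSum.sum t n ≈ sum λ i → t i n
  sum-coefficient {zero}  t n = con0≈0 n
  sum-coefficient {suc m} t n = +-congˡ (sum-coefficient (t ∘ suc) n)

  open Matrices seriesRing using (Matrix; det)

  -- Off the diagonal the first row has constant terms `0#`, so only term `zero` contributes, and
  -- its minor satisfies the same hypothesis.
  det-constantTerm : ∀ {n} (M : Matrix n n) →
    (∀ i j → M i j 0 ≈ (if toℕ i ≡ᵇ toℕ j then 1# else 0#)) → det M 0 ≈ 1#
  det-constantTerm {zero}  M eq = refl
  det-constantTerm {suc n} M eq = begin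
    term zero 0 + SeriesSum.sum (λ j → term (suc j)) 0
      ≈⟨ +-cong first (trans (sum-coefficient (λ j → term (suc j)) 0)
           (trans (sum-cong-≋ rest) (sum-replicate-zero n))) ⟩
    1# + 0#
      ≈⟨ +-identityʳ 1# ⟩
    1# ∎
    where
    open Determinant seriesCommutativeRing using (minor) renaming (term to detTerm)
    term : Fin (suc n) → Series
    term = detTerm M

    first : term zero 0 ≈ 1#
    first = begin
      -- At index 0 a Cauchy product unfolds to `f 0 * g 0 + 0#`, whence the trailing zeros.
      (1# * M zero zero 0 + 0#) * det (minor M zero) 0 + 0#
        ≈⟨ +-identityʳ _ ⟩
      (1# * M zero zero 0 + 0#) * det (minor M zero) 0
        ≈⟨ *-cong (trans (+-identityʳ _) (trans (*-identityˡ _) (eq zero zero)))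
             (det-constantTerm (minor M zero) λ i j → eq (suc i) (suc j)) ⟩
      1# * 1#
        ≈⟨ *-identityˡ 1# ⟩
      1# ∎

    rest : ∀ j → term (suc j) 0 ≈ 0#
    rest j = trans (+-identityʳ _) (trans (*-congʳ
      (trans (+-identityʳ _) (trans (*-congˡ (eq zero (suc j))) (zeroʳ _)))) (zeroˡ _))

-- The linear system satisfied by the powers of the Horadam sequence.

module HoradamSystem {c ℓ} (R : CommutativeRing c ℓ) (a b p q : CommutativeRing.Carrier R) where
  open CommutativeRing R hiding (zero)
  open PowerSeries R
  open PowerSeriesProperties R
  open Scalars R p q
  open Sum semiring
  open Exp semiring using (_^_; ^-homo-*; ^-congˡ; ^-congʳ)
  open CommutativeExp commutativeSemiring using (^-distrib-*)
  open Mult semiring using (×-congʳ; ×-congˡ; ×-comm-*) renaming (_×_ to _·_)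
  open RingProperties ring
  open Determinant R using (sum-zero)
  open LinearSystem seriesCommutativeRing using (lowerRow; firstRow)
  open SetoidReasoning setoid
  open Solver commutativeSemiring using (solve; _:+_; _:*_; _:=_)
  open Horadam R p q using (Δ; δ; 𝓗)
  private
    module S = CommutativeRing seriesCommutativeRing
    module SeriesSum = Sum S.semiring
  open S using () renaming (_≈_ to _≋_; _*_ to _⊛_)

  wₙ : ℕ → Carrier
  wₙ = w a b

  -- Every row of `Δ` has `k` columns, but the expansion of a `d`-th power has `d + 1` terms; this
  -- cuts off the vanishing entries with `j > d`.
  sum-trailingZeros : ∀ {m n} (t : ℕ → Carrier) → m ℕ.≤ n → (∀ j → m ℕ.≤ j → t j ≈ 0#) →
    sum {n} (t ∘ toℕ) ≈ sum {m} (t ∘ toℕ)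
  sum-trailingZeros {n = n} t z≤n eq = sum-zero {n} λ j → eq (toℕ j) z≤n
  sum-trailingZeros t (s≤s m≤n) eq =
    +-congˡ (sum-trailingZeros (t ∘ suc) m≤n λ j m≤j → eq (suc j) (s≤s m≤j))

  binomialTerm-zero : ∀ d → binomialTerm d 0 ≈ p ^ d
  binomialTerm-zero d = begin
    (d C 0) · (p ^ d * 1#)  ≈⟨ ×-congˡ (≡.trans (nCk≡nC[n∸k] {0} {d} z≤n) (nCn≡1 d)) ⟩
    p ^ d * 1# + 0#         ≈⟨ +-identityʳ _ ⟩
    p ^ d * 1#              ≈⟨ *-identityʳ _ ⟩
    p ^ d                   ∎

  binomialTerm-self : ∀ d → binomialTerm d d ≈ q ^ d
  binomialTerm-self d = begin
    (d C d) · (p ^ (d ∸ d) * q ^ d)  ≈⟨ ×-congˡ (nCn≡1 d) ⟩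
    p ^ (d ∸ d) * q ^ d + 0#         ≈⟨ +-identityʳ _ ⟩
    p ^ (d ∸ d) * q ^ d              ≈⟨ *-congʳ (^-congʳ p (ℕ.n∸n≡0 d)) ⟩
    1# * q ^ d                       ≈⟨ *-identityˡ _ ⟩
    q ^ d                            ∎

  binomialTerm-beyond : ∀ {d j} → d ℕ.< j → binomialTerm d j ≈ 0#
  binomialTerm-beyond d<j = ×-congˡ (k>n⇒nCk≡0 d<j)

  -- Since `k ∸ j` is `k ∸ d` plus `d ∸ j`, the factor `v ^ (k ∸ d)` comes out of every term and a
  -- binomial expansion remains. For consecutive terms `u`, `v` of the sequence, `p * v + q * u` is
  -- the next term.
  homogeneousBinomial : ∀ {d k} u v → d ℕ.≤ k →
    sum {suc d} (λ j → (u ^ toℕ j * v ^ (k ∸ toℕ j)) * binomialTerm d (toℕ j))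
      ≈ v ^ (k ∸ d) * (p * v + q * u) ^ d
  homogeneousBinomial {d} {k} u v d≤k = begin
    sum (λ (j : Fin (suc d)) → (u ^ toℕ j * v ^ (k ∸ toℕ j)) * binomialTerm d (toℕ j))
      ≈⟨ sum-cong-≋ {suc d} (λ j → sym (expandTerm (toℕ j) (toℕ≤pred[n] j))) ⟩
    sum (λ (j : Fin (suc d)) → v ^ (k ∸ d) * ((d C toℕ j) · ((q * u) ^ toℕ j * (p * v) ^ (d ∸ toℕ j))))
      ≈⟨ *-distribˡ-sum (v ^ (k ∸ d))
           (λ (j : Fin (suc d)) → (d C toℕ j) · ((q * u) ^ toℕ j * (p * v) ^ (d ∸ toℕ j))) ⟨
    -- `q * u` stands first because the library expansion gives the ascending powers to the first
    -- summand; the order of the recurrence is restored afterwards.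
    v ^ (k ∸ d) * Binomial.binomialExpansion commutativeSemiring (q * u) (p * v) d
      ≈⟨ *-congˡ (Binomial.theorem commutativeSemiring d (q * u) (p * v)) ⟨
    v ^ (k ∸ d) * (q * u + p * v) ^ d
      ≈⟨ *-congˡ (^-congˡ d (+-comm _ _)) ⟩
    v ^ (k ∸ d) * (p * v + q * u) ^ d ∎
    where
    expandTerm : ∀ j → j ℕ.≤ d →
      v ^ (k ∸ d) * ((d C j) · ((q * u) ^ j * (p * v) ^ (d ∸ j)))
        ≈ (u ^ j * v ^ (k ∸ j)) * binomialTerm d j
    expandTerm j j≤d = begin
      v ^ (k ∸ d) * ((d C j) · ((q * u) ^ j * (p * v) ^ (d ∸ j)))
        ≈⟨ ×-comm-* (d C j) _ _ ⟩
      (d C j) · (v ^ (k ∸ d) * ((q * u) ^ j * (p * v) ^ (d ∸ j)))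
        ≈⟨ ×-congʳ (d C j) (*-congˡ (*-cong (^-distrib-* q u j) (^-distrib-* p v (d ∸ j)))) ⟩
      (d C j) · (v ^ (k ∸ d) * (q ^ j * u ^ j * (p ^ (d ∸ j) * v ^ (d ∸ j))))
        ≈⟨ ×-congʳ (d C j) (solve 5 (λ v₁ q u p v₂ → v₁ :* (q :* u :* (p :* v₂)) := u :* (v₁ :* v₂) :* (p :* q))
             refl (v ^ (k ∸ d)) (q ^ j) (u ^ j) (p ^ (d ∸ j)) (v ^ (d ∸ j))) ⟩
      (d C j) · (u ^ j * (v ^ (k ∸ d) * v ^ (d ∸ j)) * (p ^ (d ∸ j) * q ^ j))
        ≈⟨ ×-congʳ (d C j) (*-congʳ (*-congˡ (trans (sym (^-homo-* v (k ∸ d) (d ∸ j)))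
             (^-congʳ v exponent)))) ⟩
      (d C j) · (u ^ j * v ^ (k ∸ j) * (p ^ (d ∸ j) * q ^ j))
        ≈⟨ ×-comm-* (d C j) _ _ ⟨
      u ^ j * v ^ (k ∸ j) * binomialTerm d j ∎
      where
      -- Subtraction is truncated, so both `j ≤ d` and `d ≤ k` enter.
      exponent : k ∸ d ℕ.+ (d ∸ j) ≡ k ∸ j
      exponent = ≡.trans (≡.sym (ℕ.+-∸-assoc (k ∸ d) j≤d)) (≡.cong (_∸ j) (ℕ.m∸n+n≡m d≤k))

  -x≈0 : ∀ {x} → x ≈ 0# → - x ≈ 0#
  -x≈0 x≈0 = trans (-‿cong x≈0) -0#≈0#

  -- The series Fⱼ for `j ≥ 1`. At `j = 0` the formula would differ from `𝓗` exactly in the constant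
  -- coefficient, where `𝓗` has `a ^ k`; `solution` therefore takes `𝓗` itself at index `zero`.
  mixedPowers : ℕ → ℕ → Series
  mixedPowers k j zero    = 0#
  mixedPowers k j (suc n) = wₙ n ^ j * wₙ (suc n) ^ (k ∸ j)

  module _ (k′ : ℕ) where
    private
      k : ℕ
      k = suc k′

    solution : Fin k → Series
    solution zero    = 𝓗 a b k
    solution (suc s) = mixedPowers k (suc (toℕ s))

    -- The cofactor of `- X` in the row with exponent `d`, in the form that `lowerRow` and
    -- `firstRow` produce. The binomial term for `j = 0` appears as `p ^ d`, as it does in column
    -- `zero` of `Δ`.
    coupling : ℕ → Series
    coupling d = (𝓗 a b k ⊛ con (p ^ d))
      S.+ SeriesSum.sum λ s → solution (suc s) ⊛ con (binomialTerm d (suc (toℕ s)))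

    coupling-expand : ∀ d n → coupling d n
      ≈ wₙ n ^ k * p ^ d + sum λ (s : Fin k′) → solution (suc s) n * binomialTerm d (suc (toℕ s))
    coupling-expand d n = +-cong (⊛-con (𝓗 a b k) (p ^ d) n)
      (trans (sum-coefficient (λ s → solution (suc s) ⊛ con (binomialTerm d (suc (toℕ s)))) n)
        (sum-cong-≋ λ s → ⊛-con (solution (suc s)) (binomialTerm d (suc (toℕ s))) n))

    coupling-zero : ∀ d → coupling d 0 ≈ a ^ k * p ^ d
    coupling-zero d = trans (coupling-expand d 0)
      (trans (+-congˡ (sum-zero {t = λ (s : Fin k′) → 0# * binomialTerm d (suc (toℕ s))} λ s → zeroˡ _))
        (+-identityʳ _))

    summand : ℕ → ℕ → ℕ → Carrier
    summand d m j = (wₙ m ^ j * wₙ (suc m) ^ (k ∸ j)) * binomialTerm d j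

    -- Beyond the constant coefficient, `𝓗` fits the pattern of the other unknowns as the case
    -- `j = 0`, so the sum becomes uniform in `j`.
    coupling-suc : ∀ d m → coupling d (suc m) ≈ sum {k} (summand d m ∘ toℕ)
    coupling-suc d m = trans (coupling-expand d (suc m))
      (+-congʳ (*-cong (sym (*-identityˡ _)) (sym (binomialTerm-zero d))))

    -- For `d < k` the `k` columns hold the complete binomial expansion, which the recurrence
    -- collapses to a power of the next term.
    coupling-lower : ∀ {d} → d ℕ.≤ k′ → ∀ m →
      coupling d (suc m) ≈ wₙ (suc m) ^ (k ∸ d) * wₙ (suc (suc m)) ^ d
    coupling-lower {d} d≤k′ m = begin
      coupling d (suc m)                  ≈⟨ coupling-suc d m ⟩
      sum {k} (summand d m ∘ toℕ)         ≈⟨ sum-trailingZeros (summand d m) (s≤s d≤k′)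
                                               (λ j d<j → trans (*-congˡ (binomialTerm-beyond d<j)) (zeroʳ _)) ⟩
      sum {suc d} (summand d m ∘ toℕ)     ≈⟨ homogeneousBinomial (wₙ m) (wₙ (suc m)) (ℕ.m≤n⇒m≤1+n d≤k′) ⟩
      wₙ (suc m) ^ (k ∸ d) * wₙ (suc (suc m)) ^ d ∎

    -- For `d = k` the expansion has `k + 1` terms and the row only `k` columns. The missing term
    -- `j = k` is `wₙ m ^ k * q ^ k`, which the quadratic part of the corner entry of `Δ` supplies
    -- two degrees later.
    coupling-top : ∀ m → coupling k (suc m) + wₙ m ^ k * q ^ k ≈ wₙ (suc (suc m)) ^ k
    coupling-top m = begin
      coupling k (suc m) + wₙ m ^ k * q ^ k
        ≈⟨ +-cong (trans (coupling-suc k m) (sum-cong-≋ {k} λ j →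
             reflexive (≡.cong (summand k m) (≡.sym (toℕ-inject₁ j))))) lastTerm ⟩
      sum {k} (summand k m ∘ toℕ ∘ inject₁) + summand k m (toℕ (Fin.fromℕ k))
        ≈⟨ sum-init-last (λ (j : Fin (suc k)) → summand k m (toℕ j)) ⟨
      sum {suc k} (summand k m ∘ toℕ)
        ≈⟨ homogeneousBinomial {k} (wₙ m) (wₙ (suc m)) ℕ.≤-refl ⟩
      wₙ (suc m) ^ (k ∸ k) * wₙ (suc (suc m)) ^ k
        ≈⟨ *-congʳ (^-congʳ (wₙ (suc m)) (ℕ.n∸n≡0 k)) ⟩
      1# * wₙ (suc (suc m)) ^ k
        ≈⟨ *-identityˡ _ ⟩
      wₙ (suc (suc m)) ^ k ∎
      where
      lastTerm : wₙ m ^ k * q ^ k ≈ summand k m (toℕ (Fin.fromℕ k))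
      lastTerm = begin
        wₙ m ^ k * q ^ k
          ≈⟨ *-cong (trans (sym (*-identityʳ _)) (*-congˡ (^-congʳ (wₙ (suc m)) (≡.sym (ℕ.n∸n≡0 k)))))
               (sym (binomialTerm-self k)) ⟩
        summand k m k
          ≡⟨ ≡.cong (summand k m) (≡.sym (toℕ-fromℕ k)) ⟩
        summand k m (toℕ (Fin.fromℕ k)) ∎

    -- Compared degree by degree. Degree 0 vanishes on both sides; in degree 1 the initial values
    -- `a`, `b` produce `g`, through `a ^ (k ∸ d) * a ^ d ≈ a ^ k`; from degree 2 on,
    -- `coupling-lower` cancels the unknown, because `k ∸ d` is `suc (toℕ r)`.
    lowerEquation : ∀ (r : Fin k′) → let d = k′ ∸ toℕ r in
      con (g a b k d) ⊛ X ≋ solution (suc r) S.+ S.- (X ⊛ coupling d)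
    lowerEquation r zero = trans (con-X-zero (g a b k (k′ ∸ toℕ r)))
      (sym (x≈y⇒x∙y⁻¹≈ε (sym (X-⊛-zero (coupling (k′ ∸ toℕ r))))))
    lowerEquation r (suc zero) = begin
      (con (g a b k d) ⊛ X) 1
        ≈⟨ con-X-suc (g a b k d) 0 ⟩
      (b ^ d - a ^ d * p ^ d) * a ^ (k ∸ d)
        ≈⟨ [y-z]x≈yx-zx _ _ _ ⟩
      b ^ d * a ^ (k ∸ d) - a ^ d * p ^ d * a ^ (k ∸ d)
        ≈⟨ +-cong
             (trans (*-comm _ _) (*-congʳ (^-congʳ a k∸d)))
             (-‿cong (trans (solve 3 (λ x y z → x :* y :* z := z :* x :* y) refl (a ^ d) (p ^ d) (a ^ (k ∸ d)))
               (*-congʳ (trans (sym (^-homo-* a (k ∸ d) d)) (^-congʳ a (ℕ.m∸n+n≡m d≤k)))))) ⟩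
      a ^ suc (toℕ r) * b ^ d - a ^ k * p ^ d
        ≈⟨ +-congˡ (-‿cong (trans (X-⊛-suc (coupling d) 0) (coupling-zero d))) ⟨
      solution (suc r) 1 - (X ⊛ coupling d) 1 ∎
      where
      d : ℕ
      d = k′ ∸ toℕ r
      d≤k : d ℕ.≤ k
      d≤k = ℕ.m≤n⇒m≤1+n (ℕ.m∸n≤m k′ (toℕ r))
      k∸d : k ∸ d ≡ suc (toℕ r)
      k∸d = ℕ.m∸[m∸n]≡n {k} {suc (toℕ r)} (ℕ.m≤n⇒m≤1+n (toℕ<n r))
    lowerEquation r (suc (suc m)) = begin
      (con (g a b k d) ⊛ X) (suc (suc m))
        ≈⟨ con-X-suc (g a b k d) (suc m) ⟩
      0#
        ≈⟨ x≈y⇒x∙y⁻¹≈ε (*-congʳ (^-congʳ (wₙ (suc m)) (≡.sym k∸d))) ⟨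
      wₙ (suc m) ^ suc (toℕ r) * wₙ (suc (suc m)) ^ d - wₙ (suc m) ^ (k ∸ d) * wₙ (suc (suc m)) ^ d
        ≈⟨ +-congˡ (-‿cong (trans (X-⊛-suc (coupling d) (suc m)) (coupling-lower (ℕ.m∸n≤m k′ (toℕ r)) m))) ⟨
      solution (suc r) (suc (suc m)) - (X ⊛ coupling d) (suc (suc m)) ∎
      where
      d : ℕ
      d = k′ ∸ toℕ r
      k∸d : k ∸ d ≡ suc (toℕ r)
      k∸d = ℕ.m∸[m∸n]≡n {k} {suc (toℕ r)} (ℕ.m≤n⇒m≤1+n (toℕ<n r))

    -- The same comparison: degree 0 leaves `a ^ k`, degree 1 leaves `b ^ k - a ^ k * p ^ k`, and in
    -- higher degrees `coupling-top` makes everything cancel.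
    firstEquation : con (a ^ k) S.+ (con (g a b k k) ⊛ X)
      ≋ 𝓗 a b k S.+ S.- (X ⊛ coupling k) S.+ S.- (X ⊛ (X ⊛ (𝓗 a b k ⊛ con (q ^ k))))
    firstEquation zero = begin
      a ^ k + (con (g a b k k) ⊛ X) 0
        ≈⟨ +-congˡ (con-X-zero (g a b k k)) ⟩
      a ^ k + 0#
        ≈⟨ +-congˡ (x≈y⇒x∙y⁻¹≈ε (sym (X-⊛-zero (coupling k)))) ⟨
      a ^ k + (0# - (X ⊛ coupling k) 0)
        ≈⟨ +-congˡ (+-identityˡ _) ⟩
      a ^ k - (X ⊛ coupling k) 0
        ≈⟨ +-identityʳ _ ⟨
      a ^ k - (X ⊛ coupling k) 0 + 0#
        ≈⟨ +-congˡ (trans (-‿cong (X-⊛-zero (X ⊛ (𝓗 a b k ⊛ con (q ^ k))))) -0#≈0#) ⟨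
      a ^ k - (X ⊛ coupling k) 0 - (X ⊛ (X ⊛ (𝓗 a b k ⊛ con (q ^ k)))) 0 ∎
    firstEquation (suc zero) = begin
      0# + (con (g a b k k) ⊛ X) 1
        ≈⟨ trans (+-identityˡ _) (con-X-suc (g a b k k) 0) ⟩
      (b ^ k - a ^ k * p ^ k) * a ^ (k ∸ k)
        ≈⟨ trans (*-congˡ (^-congʳ a (ℕ.n∸n≡0 k))) (*-identityʳ _) ⟩
      b ^ k - a ^ k * p ^ k
        ≈⟨ +-congˡ (-‿cong (trans (X-⊛-suc (coupling k) 0) (coupling-zero k))) ⟨
      b ^ k - (X ⊛ coupling k) 1
        ≈⟨ +-identityʳ _ ⟨
      b ^ k - (X ⊛ coupling k) 1 + 0#
        ≈⟨ +-congˡ (trans (-‿cong (trans (X-⊛-suc (X ⊛ (𝓗 a b k ⊛ con (q ^ k))) 0)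
             (X-⊛-zero (𝓗 a b k ⊛ con (q ^ k))))) -0#≈0#) ⟨
      b ^ k - (X ⊛ coupling k) 1 - (X ⊛ (X ⊛ (𝓗 a b k ⊛ con (q ^ k)))) 1 ∎
    firstEquation (suc (suc m)) = begin
      0# + (con (g a b k k) ⊛ X) (suc (suc m))
        ≈⟨ trans (+-identityˡ _) (con-X-suc (g a b k k) (suc m)) ⟩
      0#
        ≈⟨ x≈y⇒x∙y⁻¹≈ε (sym (coupling-top m)) ⟨
      wₙ (suc (suc m)) ^ k - (coupling k (suc m) + wₙ m ^ k * q ^ k)
        ≈⟨ trans (+-congˡ (sym (-‿+-comm _ _))) (sym (+-assoc _ _ _)) ⟩
      wₙ (suc (suc m)) ^ k - coupling k (suc m) - wₙ m ^ k * q ^ k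
        ≈⟨ +-cong (+-congˡ (-‿cong (X-⊛-suc (coupling k) (suc m))))
             (-‿cong (trans (X-⊛-suc (X ⊛ (𝓗 a b k ⊛ con (q ^ k))) (suc m))
               (trans (X-⊛-suc (𝓗 a b k ⊛ con (q ^ k)) m) (⊛-con (𝓗 a b k) (q ^ k) m)))) ⟨
      wₙ (suc (suc m)) ^ k - (X ⊛ coupling k) (suc (suc m))
        - (X ⊛ (X ⊛ (𝓗 a b k ⊛ con (q ^ k)))) (suc (suc m)) ∎

    -- Both row shapes match by unfolding; in particular `≡ᵇ` on two successors reduces to the
    -- comparison of their predecessors that `lowerRow` contains.
    Δ-solution : ∀ r → δ a b k r zero ≋ SeriesSum.sum λ j → solution j ⊛ Δ k r j
    Δ-solution zero = S.trans firstEquation (S.sym (firstRow X (𝓗 a b k) (con (p ^ k)) (con (q ^ k))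
      (solution ∘ suc) λ s → con (binomialTerm k (suc (toℕ s)))))
    Δ-solution (suc r) = S.trans (lowerEquation r) (S.sym (lowerRow X (𝓗 a b k) (con (p ^ (k′ ∸ toℕ r)))
      (solution ∘ suc) (λ s → con (binomialTerm (k′ ∸ toℕ r) (suc (toℕ s)))) r))

    δ-rest : ∀ r j → δ a b k r (suc j) ≋ Δ k r (suc j)
    δ-rest zero    j n = refl
    δ-rest (suc r) j n = refl

    Δ-constantTerm : ∀ i j → Δ k i j 0 ≈ (if toℕ i ≡ᵇ toℕ j then 1# else 0#)
    Δ-constantTerm zero zero = trans
      (+-cong
        (trans (+-congˡ (-x≈0 (con-X-zero (p ^ k)))) (+-identityʳ 1#))
        (-x≈0 (trans (con-⊛ (q ^ k) (X ⊛ (X ⊛ S.1#)) 0)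
          (trans (*-congˡ (X-⊛-zero (X ⊛ S.1#))) (zeroʳ _)))))
      (+-identityʳ 1#)
    Δ-constantTerm zero    (suc j) = -x≈0 (X-⊛-zero (con (binomialTerm k (suc (toℕ j)))))
    Δ-constantTerm (suc i) zero    = -x≈0 (con-X-zero (p ^ (k′ ∸ toℕ i)))
    Δ-constantTerm (suc i) (suc j) = trans
      (+-cong (indicator-constantTerm (toℕ i ≡ᵇ toℕ j))
        (-x≈0 (X-⊛-zero (con (binomialTerm (k′ ∸ toℕ i) (suc (toℕ j)))))))
      (+-identityʳ _)
      where
      -- Taking a coefficient does not reduce through `if` on an open condition, so the boolean is
      -- generalised and split.
      indicator-constantTerm : ∀ e → (if e then S.1# else S.0#) 0 ≈ (if e then 1# else 0#)
      indicator-constantTerm false = refl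
      indicator-constantTerm true  = refl

-- Conclusion: division by the determinant of `Δ`.

theorem1p1 : ∀ {c ℓ} (R : CommutativeRing c ℓ) (a b p q : CommutativeRing.Carrier R) (k : ℕ) → 1 ℕ.≤ k →
    let open RawRing (PowerSeries.seriesRing R)
        open Matrices (PowerSeries.seriesRing R)
        open Horadam R p q
    in  Σ (Invertible _≈_ 1# _*_ (det (Δ k))) λ (detΔ⁻¹ , _) →
          𝓗 a b k ≈ det (δ a b k) * detΔ⁻¹
theorem1p1 R a b p q (suc k′) _ =
  (detΔ⁻¹ , inverseˡ , S.trans (S.*-comm (det (Δ k)) detΔ⁻¹) inverseˡ) , λ n → S.sym (begin
    det (δ a b k) S.* detΔ⁻¹
      ≈⟨ S.*-congʳ {detΔ⁻¹} {det (δ a b k)} {𝓗 a b k S.* det (Δ k)}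
           (cramer (Δ k) (δ a b k) (solution k′) (Δ-solution k′) (δ-rest k′)) ⟩
    𝓗 a b k S.* det (Δ k) S.* detΔ⁻¹
      ≈⟨ S.*-assoc (𝓗 a b k) (det (Δ k)) detΔ⁻¹ ⟩
    𝓗 a b k S.* (det (Δ k) S.* detΔ⁻¹)
      ≈⟨ S.*-congˡ {𝓗 a b k} {det (Δ k) S.* detΔ⁻¹} {S.1#} (S.trans (S.*-comm (det (Δ k)) detΔ⁻¹) inverseˡ) ⟩
    𝓗 a b k S.* S.1#
      ≈⟨ S.*-identityʳ (𝓗 a b k) ⟩
    𝓗 a b k ∎) n
  where
  k : ℕ
  k = suc k′
  open PowerSeriesProperties R
  module S = CommutativeRing seriesCommutativeRing
  open Matrices (PowerSeries.seriesRing R)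
  open Horadam R p q
  open HoradamSystem R a b p q
  open Determinant seriesCommutativeRing using (cramer)
  open SetoidReasoning S.setoid

  detΔ⁻¹ : S.Carrier
  detΔ⁻¹ = quotient (det (Δ k)) S.1#

  inverseˡ : detΔ⁻¹ S.* det (Δ k) S.≈ S.1#
  -- Reduced to constant terms, `Δ` is the identity matrix, so its determinant can serve as the
  -- divisor of `1#` in long division.
  inverseˡ = quotient-⊛ (det (Δ k)) (det-constantTerm (Δ k) (Δ-constantTerm k′)) S.1#
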